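{- (a) There exist positive constants $\kappa_1, \kappa_2$ such that for all integers $k \ge 2$ and $m \ge 1$, if $G$ is the Cartesian product of $m$ copies of the complete graph $K_k$ and $n = |V(G)| = k^m$, then $$\frac{\kappa_1 n}{k m \sqrt{m}} \le c_{\infty}(G) \le \min\left\{\frac{n}{k}, \frac{\kappa_2 n}{\sqrt{m}}\right\}.$$ (b) There exist constants $\eta_1, \eta_2 > 0$ such that for every $m \ge 1$ the $m$-hypercube $\mathcal{H}_m$, with $n = 2^m$ vertices, satisfies $$\frac{\eta_1 n}{m\sqrt{m}} \le c_{\infty}(\mathcal{H}_m) \le \frac{\eta_2 n}{m}.$$
   Context: The Cartesian product of $G_1,\dots,G_m$ has vertex set $V(G_1)\times\cdots\times V(G_m)$, with $(u_1,\dots,u_m)$ adjacent to $(v_1,\dots,v_m)$ iff there is an index $j$ with $u_i = v_i$ for all $i \neq j$ and $u_j v_j \in E(G_j)$. The $m$-hypercube $\mathcal{H}_m$ is the Cartesian product of $m$ copies of a single edge $K_2$. Cops and Robber game with a fast robber: the cops first choose initial vertices (several may share a vertex), then the robber chooses a vertex. Players alternate rounds, cops first. Each cop stays or moves to an adjacent vertex; the robber may stay or move along any path from her current vertex containing no vertex occupied by a cop. The cops win if a cop moves onto the robber's vertex; the robber wins if she evades forever. $c_{\infty}(G)$ is the minimum number of cops guaranteeing a cop win. -}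

module Defs where

open import Data.Nat using (ℕ; zero; suc; _*_; _^_; _≤_; _<_)
open import Data.Fin using (Fin)
open import Data.Vec using (Vec; lookup)
open import Data.Product using (Σ; ∃; _×_)
open import Data.Sum using (_⊎_)
open import Relation.Nullary using (¬_)
open import Relation.Binary.PropositionalEquality using (_≡_; _≢_)

record Graph : Set₁ where
  field
    V   : Set
    _~_ : V → V → Set
open Graph public

K : ℕ → Graph
K k = record { V = Fin k ; _~_ = λ u v → u ≢ v }

CartPow : Graph → ℕ → Graph
CartPow G m = record
  { V   = Vec (V G) m
  ; _~_ = λ u v → Σ (Fin m) λ j →
            ((i : Fin m) → i ≢ j → lookup u i ≡ lookup v i)
            × (_~_ G (lookup u j) (lookup v j))
  }

Hypercube : ℕ → Graph
Hypercube m = CartPow (K 2) m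

module Game (G : Graph) (c : ℕ) where
  Cops : Set
  Cops = Fin c → V G

  Occ : Cops → V G → Set
  Occ C v = ∃ λ i → C i ≡ v

  CopMove : Cops → Cops → Set
  CopMove C C' = (i : Fin c) → (C i ≡ C' i) ⊎ (_~_ G (C i) (C' i))

  -- robber moves along a path (possibly of length 0) from r to r'
  -- whose vertices (after the start) are not occupied by cops;
  -- the start vertex is unoccupied in every use below.
  data Avoid (C : Cops) : V G → V G → Set where
    here : ∀ {u} → Avoid C u u
    step : ∀ {u v w} → _~_ G u v → ¬ Occ C v → Avoid C v w → Avoid C u w

  -- CopWin C r: cops at C, robber at r, cops to move; cops can force
  -- capture in finitely many rounds.
  data CopWin : Cops → V G → Set where
    win : ∀ {C r} (C' : Cops) → CopMove C C' →
          (Occ C' r ⊎ ((r' : V G) → Avoid C' r r' → CopWin C' r')) →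
          CopWin C r

  CopsWin : Set
  CopsWin = Σ Cops λ C → (r : V G) → ¬ Occ C r → CopWin C r

CopsWin : Graph → ℕ → Set
CopsWin G c = Game.CopsWin G c

IsCInf : Graph → ℕ → Set
IsCInf G c = CopsWin G c × ((c' : ℕ) → c' < c → ¬ CopsWin G c')

{-# OPTIONS --safe #-}
-- Upper bounds: a dominating set of cops catches the robber in one move. A facet x₀ = 0 dominates, and so
-- does every fibre of the Hamming syndrome applied to the supports of the vertices; with r parity bits,
-- 2^r ≤ m ≤ 2·2^r, the smallest fibre has at most n/2^r vertices.
--
-- Lower bound: with few cops, the graph minus the closed neighbourhood of the cops always has a component
-- with more than n/2 vertices. Two such components, before and after a cop move, intersect, so the robber
-- can run from one to the next. The component exists by a vertex isoperimetric inequality: a set of density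
-- a has boundary density at least a(1-a)/(4s), where s² ≥ m. It is proved by induction on the dimension
-- with coefficients c_j = (2m-j)/(4sm) in dimension j. If the slices have densities a_i with maximum M,
-- then the boundary in slice i has density at least max(c_j a_i(1-a_i), M - a_i), which is at least
-- c_{j+1} (a_i(1-a_i) + (M-a_i)²), and the last factor is the tangent of t(1-t) at M, evaluated at a_i.
module Submission where

open import Defs
open import Data.Nat using (ℕ; zero; suc; _+_; _*_; _∸_; _^_; _≤_; _<_; _⊔_; z≤n; s≤s; NonZero; >-nonZero; >-nonZero⁻¹)
open import Data.Nat.Properties
open import Data.Nat.Tactic.RingSolver using (solve-∀)
open import Algebra.Properties.CommutativeMonoid.Sum +-0-commutativeMonoid using (sum; ∑-distrib-+; sum-cong-≗)
open import Data.Bool using (Bool; true; false; not; if_then_else_; _∧_; _∨_)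
open import Data.Fin using (Fin; zero; suc)
import Data.Fin.Properties as Fin
open import Data.List as List using (List; []; _∷_; _++_; length)
open import Data.List.Properties using (length-++; length-map)
open import Data.List.Membership.Propositional using (_∈_)
open import Data.List.Membership.Propositional.Properties using (∈-++⁺ˡ; ∈-++⁺ʳ; ∈-map⁺)
open import Data.List.Relation.Unary.Any as Any using (here; there)
open import Data.List.Relation.Unary.Any.Properties using (lookup-index)
open import Data.Vec using (Vec; []; _∷_; lookup; replicate; zipWith)
open import Data.Vec.Properties using (≡-dec)
open import Data.Product using (Σ; ∃; _×_; _,_; proj₁; proj₂)
open import Data.Sum using (_⊎_; inj₁; inj₂)
open import Data.Empty using (⊥; ⊥-elim)
open import Function using (_∘_; const)
open import Relation.Nullary using (¬_; Dec; yes; no; does; contradiction)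
open import Relation.Nullary.Decidable using (¬¬-excluded-middle)
open import Relation.Binary.Construct.Closure.ReflexiveTransitive using (Star; ε; _◅_; _◅◅_; reverse)
open import Relation.Binary.PropositionalEquality using (_≡_; _≢_; refl; sym; trans; cong; cong₂; subst; subst₂; module ≡-Reasoning)

-- Sums, extrema and Boolean disjunctions over `Fin`.

sum-mono : ∀ {n} {f g : Fin n → ℕ} → (∀ i → f i ≤ g i) → sum f ≤ sum g
sum-mono {zero}  f≤g = z≤n
sum-mono {suc n} f≤g = +-mono-≤ (f≤g zero) (sum-mono (f≤g ∘ suc))

sum-const : ∀ n c → sum {n} (λ _ → c) ≡ n * c
sum-const zero    c = refl
sum-const (suc n) c = cong (c +_) (sum-const n c)

sum-*ˡ : ∀ {n} c (f : Fin n → ℕ) → sum (λ i → c * f i) ≡ c * sum f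
sum-*ˡ {zero}  c f = sym (*-zeroʳ c)
sum-*ˡ {suc n} c f = trans (cong (c * f zero +_) (sum-*ˡ c (f ∘ suc))) (sym (*-distribˡ-+ c (f zero) _))

-- Leastness is the form that the isoperimetric induction uses: a number bounding every slice bounds
-- the largest one. The empty family gets the value 0, so that `k = 0` is covered.
supremum : ∀ {n} (f : Fin n → ℕ) → Σ ℕ λ μ → (∀ i → f i ≤ μ) × (∀ b → (∀ i → f i ≤ b) → μ ≤ b)
supremum {zero}  f = 0 , (λ ()) , (λ _ _ → z≤n)
supremum {suc n} f with supremum (f ∘ suc)
... | μ , upper , least =
  f zero ⊔ μ ,
  (λ { zero → m≤m⊔n (f zero) μ ; (suc i) → ≤-trans (upper i) (m≤n⊔m (f zero) μ) }) ,
  (λ b f≤b → ⊔-lub (f≤b zero) (least b (f≤b ∘ suc)))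

minimum : ∀ {n} (f : Fin (suc n) → ℕ) → ∃ λ i → ∀ j → f i ≤ f j
minimum {zero}  f = zero , λ { zero → ≤-refl }
minimum {suc n} f with minimum (f ∘ suc)
... | i , least with f zero ≤? f (suc i)
...   | yes p = zero , λ { zero → ≤-refl ; (suc j) → ≤-trans p (least j) }
...   | no ¬p = suc i , λ { zero → ≰⇒≥ ¬p ; (suc j) → least j }

anyFin : ∀ {n} → (Fin n → Bool) → Bool
anyFin {zero}  f = false
anyFin {suc n} f = f zero ∨ anyFin (f ∘ suc)

anyFin⁺ : ∀ {n} (f : Fin n → Bool) i → f i ≡ true → anyFin f ≡ true
anyFin⁺ f zero    p rewrite p = refl
anyFin⁺ f (suc i) p with f zero
... | true  = refl
... | false = anyFin⁺ (f ∘ suc) i p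

anyFin⁻ : ∀ {n} (f : Fin n → Bool) → anyFin f ≡ true → ∃ λ i → f i ≡ true
anyFin⁻ {suc n} f p with f zero in eq
... | true  = zero , eq
... | false with anyFin⁻ (f ∘ suc) p
...   | i , q = suc i , q

indicator : Bool → ℕ
indicator b = if b then 1 else 0

indicator-∨ : ∀ a b → indicator (a ∨ b) ≤ indicator a + indicator b
indicator-∨ true  b = m≤m+n 1 _
indicator-∨ false b = ≤-refl

indicator-mono : ∀ {a b} → (a ≡ true → b ≡ true) → indicator a ≤ indicator b
indicator-mono {false} h = z≤n
indicator-mono {true}  h rewrite h refl = ≤-refl

-- Counting vertices, one coordinate at a time.

total : ∀ {k m} → (Vec (Fin k) m → ℕ) → ℕ
total {m = zero}  w = w []
total {m = suc m} w = sum λ i → total λ x → w (i ∷ x)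

module _ {k : ℕ} where

  total-mono : ∀ {m} {v w : Vec (Fin k) m → ℕ} → (∀ x → v x ≤ w x) → total v ≤ total w
  total-mono {zero}  v≤w = v≤w []
  total-mono {suc m} v≤w = sum-mono λ i → total-mono λ x → v≤w (i ∷ x)

  total-cong : ∀ {m} {v w : Vec (Fin k) m → ℕ} → (∀ x → v x ≡ w x) → total v ≡ total w
  total-cong {zero}  v≡w = v≡w []
  total-cong {suc m} v≡w = sum-cong-≗ λ i → total-cong λ x → v≡w (i ∷ x)

  total-+ : ∀ {m} (v w : Vec (Fin k) m → ℕ) → total (λ x → v x + w x) ≡ total v + total w
  total-+ {zero}  v w = refl
  total-+ {suc m} v w = trans (sum-cong-≗ λ i → total-+ (λ x → v (i ∷ x)) (λ x → w (i ∷ x))) (∑-distrib-+ {k} _ _)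

  total-const : ∀ m c → total {k} {m} (λ _ → c) ≡ k ^ m * c
  total-const zero    c = sym (*-identityˡ c)
  total-const (suc m) c = begin
    sum {k} (λ _ → total {k} {m} (λ _ → c)) ≡⟨ sum-const k _ ⟩
    k * total {k} {m} (λ _ → c)             ≡⟨ cong (k *_) (total-const m c) ⟩
    k * (k ^ m * c)                         ≡⟨ *-assoc k (k ^ m) c ⟨
    k * k ^ m * c                           ∎
    where open ≡-Reasoning

  total-sum : ∀ {m n} (w : Fin n → Vec (Fin k) m → ℕ) → total (λ x → sum λ i → w i x) ≡ sum λ i → total (w i)
  total-sum {m} {zero}  w = trans (total-const m 0) (*-zeroʳ (k ^ m))
  total-sum {m} {suc n} w = trans (total-+ (w zero) _) (cong (total (w zero) +_) (total-sum (w ∘ suc)))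

  card : ∀ {m} → (Vec (Fin k) m → Bool) → ℕ
  card A = total (indicator ∘ A)

  card-mono : ∀ {m} {A B : Vec (Fin k) m → Bool} → (∀ x → A x ≡ true → B x ≡ true) → card A ≤ card B
  card-mono A⊆B = total-mono λ x → indicator-mono (A⊆B x)

  card-∪ : ∀ {m} (A B : Vec (Fin k) m → Bool) → card (λ x → A x ∨ B x) ≤ card A + card B
  card-∪ A B = ≤-trans (total-mono λ x → indicator-∨ (A x) (B x)) (≤-reflexive (total-+ (indicator ∘ A) (indicator ∘ B)))

  card-∁ : ∀ {m} (A : Vec (Fin k) m → Bool) → card A + card (not ∘ A) ≡ k ^ m
  card-∁ {m} A = begin
    card A + card (not ∘ A)                                 ≡⟨ total-+ (indicator ∘ A) (indicator ∘ not ∘ A) ⟨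
    total (λ x → indicator (A x) + indicator (not (A x)))   ≡⟨ total-cong (λ x → lemma (A x)) ⟩
    total {k} {m} (λ _ → 1)                                 ≡⟨ total-const m 1 ⟩
    k ^ m * 1                                               ≡⟨ *-identityʳ _ ⟩
    k ^ m                                                   ∎
    where
    open ≡-Reasoning
    lemma : ∀ b → indicator b + indicator (not b) ≡ 1
    lemma true  = refl
    lemma false = refl

  card-disjoint : ∀ {m} (A B : Vec (Fin k) m → Bool) → (∀ x → A x ≡ true → B x ≡ true → ⊥) → card A + card B ≤ k ^ m
  card-disjoint A B A∩B=∅ = ≤-trans (+-monoʳ-≤ (card A) (card-mono lemma)) (≤-reflexive (card-∁ A))
    where
    lemma : ∀ x → B x ≡ true → not (A x) ≡ true
    lemma x Bx with A x in eq
    ... | true  = ⊥-elim (A∩B=∅ x eq Bx)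
    ... | false = refl

  card-anyFin : ∀ {m n} (A : Fin n → Vec (Fin k) m → Bool) → card (λ x → anyFin λ i → A i x) ≤ sum λ i → card (A i)
  card-anyFin {m} {zero}  A = ≤-reflexive (trans (total-const m 0) (*-zeroʳ (k ^ m)))
  card-anyFin {m} {suc n} A = ≤-trans (card-∪ (A zero) _) (+-monoʳ-≤ _ (card-anyFin (A ∘ suc)))

  is : ∀ {m} → Vec (Fin k) m → Vec (Fin k) m → Bool
  is u x = does (≡-dec Fin._≟_ u x)

  is⁺ : ∀ {m} (u : Vec (Fin k) m) → is u u ≡ true
  is⁺ u with ≡-dec Fin._≟_ u u
  ... | yes _ = refl
  ... | no ¬p = contradiction refl ¬p

sum-point : ∀ {n} (i : Fin n) → sum (λ j → indicator (does (i Fin.≟ j))) ≡ 1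
sum-point {suc n} zero    = cong suc (trans (sum-const n 0) (*-zeroʳ n))
sum-point {suc n} (suc i) = sum-point i

card-point : ∀ {k m} (u : Vec (Fin k) m) → card (is u) ≡ 1
card-point []          = refl
card-point {k} {suc m} (i ∷ u) = trans (sum-cong-≗ λ j → lemma (does (i Fin.≟ j))) (sum-point i)
  where
  lemma : ∀ b → card (λ x → b ∧ is u x) ≡ indicator b
  lemma true  = card-point u
  lemma false = trans (total-const m 0) (*-zeroʳ (k ^ m))

-- Closed neighbourhoods

-- A vertex of slice `i` is reached inside the slice or along its line in the first coordinate. The
-- two disjuncts yield the two lower bounds for a slice in the isoperimetric induction.
N[_] : ∀ {k m} → (Vec (Fin k) m → Bool) → Vec (Fin k) m → Bool
N[ A ] []      = A []
N[ A ] (i ∷ x) = N[ (λ y → A (i ∷ y)) ] x ∨ anyFin (λ j → A (j ∷ x))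

∨-introˡ : ∀ {a} b → a ≡ true → a ∨ b ≡ true
∨-introˡ b refl = refl

∨-introʳ : ∀ a {b} → b ≡ true → a ∨ b ≡ true
∨-introʳ true  _ = refl
∨-introʳ false p = p

∨-elim : ∀ a {b} → a ∨ b ≡ true → a ≡ true ⊎ b ≡ true
∨-elim true  p = inj₁ refl
∨-elim false p = inj₂ p

module _ {k : ℕ} where

  A⊆N[A] : ∀ {m} (A : Vec (Fin k) m → Bool) x → A x ≡ true → N[ A ] x ≡ true
  A⊆N[A] A []      p = p
  A⊆N[A] A (i ∷ x) p = ∨-introˡ _ (A⊆N[A] _ x p)

  lookup-ext : ∀ {m} (x y : Vec (Fin k) m) → (∀ i → lookup x i ≡ lookup y i) → x ≡ y
  lookup-ext []      []      h = refl
  lookup-ext (a ∷ x) (b ∷ y) h = cong₂ _∷_ (h zero) (lookup-ext x y (h ∘ suc))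

  ∼-sym : ∀ {m} (x y : Vec (Fin k) m) → _~_ (CartPow (K k) m) x y → _~_ (CartPow (K k) m) y x
  ∼-sym x y (j , same , diff) = j , (λ i i≢j → sym (same i i≢j)) , (diff ∘ sym)

  ∼-head : ∀ {m} {i j : Fin k} → i ≢ j → (x : Vec (Fin k) m) → _~_ (CartPow (K k) (suc m)) (i ∷ x) (j ∷ x)
  ∼-head i≢j x = zero , (λ { zero p → contradiction refl p ; (suc l) _ → refl }) , i≢j

  ∼-tail : ∀ {m} (i : Fin k) {x y : Vec (Fin k) m} → _~_ (CartPow (K k) m) x y → _~_ (CartPow (K k) (suc m)) (i ∷ x) (i ∷ y)
  ∼-tail i (j , same , diff) = suc j , (λ { zero _ → refl ; (suc l) p → same l (p ∘ cong suc) }) , diff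

  N[]-closed : ∀ {m} (A : Vec (Fin k) m → Bool) {y x} → A y ≡ true → _~_ (CartPow (K k) m) y x → N[ A ] x ≡ true
  N[]-closed A {a ∷ y} {b ∷ x} Ay (zero , same , diff) with lookup-ext y x (λ i → same (suc i) λ ())
  ... | refl = ∨-introʳ (N[ _ ] x) (anyFin⁺ (λ j → A (j ∷ x)) a Ay)
  N[]-closed A {a ∷ y} {b ∷ x} Ay (suc j , same , diff) with same zero (λ ())
  ... | refl = ∨-introˡ _ (N[]-closed (λ z → A (a ∷ z)) {y} {x} Ay (j , (λ i p → same (suc i) (p ∘ Fin.suc-injective)) , diff))

  N[]⁻ : ∀ {m} (A : Vec (Fin k) m → Bool) x → N[ A ] x ≡ true → ∃ λ y → A y ≡ true × (y ≡ x ⊎ _~_ (CartPow (K k) m) y x)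
  N[]⁻ A []      p = [] , p , inj₁ refl
  N[]⁻ A (i ∷ x) p with ∨-elim (N[ (λ y → A (i ∷ y)) ] x) p
  ... | inj₁ q with N[]⁻ (λ y → A (i ∷ y)) x q
  ...   | y , Ay , inj₁ refl = i ∷ y , Ay , inj₁ refl
  ...   | y , Ay , inj₂ y~x  = i ∷ y , Ay , inj₂ (∼-tail i y~x)
  N[]⁻ A (i ∷ x) p | inj₂ q with anyFin⁻ (λ j → A (j ∷ x)) q
  ... | j , Aj with j Fin.≟ i
  ...   | yes refl = j ∷ x , Aj , inj₁ refl
  ...   | no j≢i   = j ∷ x , Aj , inj₂ (∼-head j≢i x)

  -- Each of the `m` lines through a vertex is charged all its `k` points, the vertex itself
  -- included; for `k ≥ 2` this overcount costs at most a factor 2.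
  card-N[] : ∀ {m} (A : Vec (Fin k) m → Bool) → card N[ A ] ≤ (1 + m * k) * card A
  card-N[] {zero}  A = ≤-reflexive (sym (*-identityˡ _))
  card-N[] {suc m} A = begin
    sum (λ i → card (λ x → N[ A ] (i ∷ x)))                                      ≤⟨ sum-mono (λ i → card-∪ N[ slice i ] _) ⟩
    sum (λ i → card N[ slice i ] + card (λ x → anyFin (λ j → A (j ∷ x))))        ≤⟨ sum-mono (λ i → +-mono-≤ (card-N[] (slice i)) (card-anyFin slice)) ⟩
    sum (λ i → (1 + m * k) * card (slice i) + card A)                            ≡⟨ ∑-distrib-+ {k} _ _ ⟩
    sum (λ i → (1 + m * k) * card (slice i)) + sum {k} (λ _ → card A)            ≡⟨ cong₂ _+_ (sum-*ˡ (1 + m * k) (card ∘ slice)) (sum-const k (card A)) ⟩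
    (1 + m * k) * card A + k * card A                                            ≡⟨ lemma m k (card A) ⟩
    (1 + suc m * k) * card A                                                     ∎
    where
    open ≤-Reasoning
    slice : Fin k → Vec (Fin k) m → Bool
    slice i x = A (i ∷ x)
    lemma : ∀ m k a → (1 + m * k) * a + k * a ≡ (1 + suc m * k) * a
    lemma = solve-∀

-- Vertex isoperimetry

4xy≤[x+y]² : ∀ x y → 4 * (x * y) ≤ (x + y) * (x + y)
4xy≤[x+y]² x y with ≤-total x y
... | inj₁ x≤y with m≤n⇒∃[o]m+o≡n x≤y
...   | d , refl = ≤-trans (m≤m+n _ (d * d)) (≤-reflexive (lemma x d))
  where
  lemma : ∀ x d → 4 * (x * (x + d)) + d * d ≡ (x + (x + d)) * (x + (x + d))
  lemma = solve-∀
4xy≤[x+y]² x y | inj₂ y≤x with m≤n⇒∃[o]m+o≡n y≤x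
...   | d , refl = ≤-trans (m≤m+n _ (d * d)) (≤-reflexive (lemma y d))
  where
  lemma : ∀ y d → 4 * ((y + d) * y) + d * d ≡ (y + d + y) * (y + d + y)
  lemma = solve-∀

-- With the densities a = α/n, ε = e/n and c = γ/D this reads: a boundary density that is at least
-- (c + 1/D) a(1-a) and at least ε is at least c (a(1-a) + ε²).
slice-bound : ∀ D γ n G e x → 2 * γ ≤ D → γ * γ * γ ≤ D * D → 4 * G ≤ n * n → e ≤ n →
              suc γ * G ≤ D * n * x → e ≤ x → γ * (G + e * e) ≤ D * n * x
slice-bound D γ n G e x 2γ≤D γ³≤D² 4G≤n² e≤n γ'G≤Dnx e≤x = ≮⇒≥ λ Dnx< → <-irrefl refl (absurd Dnx<)
  where
  open ≤-Reasoning
  -- A violation forces `G < γe²` by the first bound on `x`, and `Dne < 2γG` by `e ≤ x`. Squaring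
  -- the second and inserting it into the first gives `G(Dn)² < 4γ³G²`, against `γ³ ≤ D²` and
  -- `4G ≤ n²`.
  absurd : D * n * x < γ * (G + e * e) → G * (D * n * (D * n)) < G * (D * n * (D * n))
  absurd Dnx< = begin-strict
    G * (D * n * (D * n))               ≤⟨ *-monoˡ-≤ _ (<⇒≤ G<γe²) ⟩
    γ * (e * e) * (D * n * (D * n))     ≡⟨ lem1 γ e (D * n) ⟩
    γ * (D * n * e * (D * n * e))       <⟨ *-monoʳ-< γ (*-mono-< Dne<2γG Dne<2γG) ⟩
    γ * (2 * (γ * G) * (2 * (γ * G)))   ≡⟨ lem2 γ G ⟩
    γ * γ * γ * (G * (4 * G))           ≤⟨ *-mono-≤ γ³≤D² (*-monoʳ-≤ G 4G≤n²) ⟩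
    D * D * (G * (n * n))               ≡⟨ lem3 D G n ⟩
    G * (D * n * (D * n))               ∎
    where
    lem1 : ∀ γ e p → γ * (e * e) * (p * p) ≡ γ * (p * e * (p * e))
    lem1 = solve-∀
    lem2 : ∀ γ G → γ * (2 * (γ * G) * (2 * (γ * G))) ≡ γ * γ * γ * (G * (4 * G))
    lem2 = solve-∀
    lem3 : ∀ D G n → D * D * (G * (n * n)) ≡ G * (D * n * (D * n))
    lem3 = solve-∀
    γ≢0 : NonZero γ
    γ≢0 = m*n≢0⇒m≢0 γ {{>-nonZero (≤-<-trans z≤n Dnx<)}}
    instance _ = γ≢0
    G<γe² : G < γ * (e * e)
    G<γe² = +-cancelʳ-< (γ * G) G (γ * (e * e)) (begin-strict
      suc γ * G                 ≤⟨ γ'G≤Dnx ⟩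
      D * n * x                 <⟨ Dnx< ⟩
      γ * (G + e * e)           ≡⟨ *-distribˡ-+ γ G (e * e) ⟩
      γ * G + γ * (e * e)       ≡⟨ +-comm (γ * G) _ ⟩
      γ * (e * e) + γ * G       ∎)
    Dne<2γG : D * n * e < 2 * (γ * G)
    Dne<2γG = +-cancelʳ-< (D * n * e) _ _ (begin-strict
      D * n * e + D * n * e                  ≡⟨ dup (D * n * e) ⟩
      2 * (D * n * e)                        ≤⟨ *-monoʳ-≤ 2 (*-monoʳ-≤ (D * n) e≤x) ⟩
      2 * (D * n * x)                        <⟨ *-monoʳ-< 2 Dnx< ⟩
      2 * (γ * (G + e * e))                  ≡⟨ lem4 γ G e ⟩
      2 * (γ * G) + 2 * γ * (e * e)          ≤⟨ +-monoʳ-≤ _ (*-mono-≤ 2γ≤D (*-monoˡ-≤ e e≤n)) ⟩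
      2 * (γ * G) + D * (n * e)              ≡⟨ cong (2 * (γ * G) +_) (*-assoc D n e) ⟨
      2 * (γ * G) + D * n * e                ∎)
      where
      dup : ∀ a → a + a ≡ 2 * a
      dup = solve-∀
      lem4 : ∀ γ G e → 2 * (γ * (G + e * e)) ≡ 2 * (γ * G) + 2 * γ * (e * e)
      lem4 = solve-∀

-- Concavity of t(1-t): its tangent at μ/n, averaged over the slices, dominates its value at the mean.
tangent-average : ∀ {k} (α β e : Fin k → ℕ) n μ → (∀ i → α i + β i ≡ n) → (∀ i → α i + e i ≡ μ) →
                  sum α * sum β ≤ k * sum (λ i → α i * β i + e i * e i)
tangent-average {k} α β e n μ α+β≡n α+e≡μ = +-cancelˡ-≤ (2 * (k * μ) * σ) _ _ (begin
  -- The tangent contains the term `-2μα`; adding `2kμσ` to both sides keeps the computation in ℕ.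
  -- The slack is exactly `E * E`.
  2 * (k * μ) * σ + σ * τ                ≡⟨ cong (λ z → 2 * z * σ + σ * τ) σ+E ⟨
  2 * (σ + E) * σ + σ * τ                ≤⟨ m≤m+n _ (E * E) ⟩
  2 * (σ + E) * σ + σ * τ + E * E        ≡⟨ lem1 σ τ E ⟩
  (σ + τ) * σ + (σ + E) * (σ + E)        ≡⟨ cong₂ (λ y z → y * σ + z * z) σ+τ σ+E ⟩
  k * n * σ + k * μ * (k * μ)            ≡⟨ lem2 k n σ μ ⟩
  k * (n * σ + k * (μ * μ))              ≡⟨ cong (k *_) total-tangent ⟨
  k * (2 * μ * σ + Q)                    ≡⟨ lem3 k μ σ Q ⟩
  2 * (k * μ) * σ + k * Q                ∎)
  where
  σ = sum α
  τ = sum β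
  E = sum e
  Q = sum (λ i → α i * β i + e i * e i)
  lem1 : ∀ σ τ E → 2 * (σ + E) * σ + σ * τ + E * E ≡ (σ + τ) * σ + (σ + E) * (σ + E)
  lem1 = solve-∀
  lem2 : ∀ k n σ μ → k * n * σ + k * μ * (k * μ) ≡ k * (n * σ + k * (μ * μ))
  lem2 = solve-∀
  lem3 : ∀ k μ σ Q → k * (2 * μ * σ + Q) ≡ 2 * (k * μ) * σ + k * Q
  lem3 = solve-∀
  σ+τ : σ + τ ≡ k * n
  σ+τ = trans (sym (∑-distrib-+ α β)) (trans (sum-cong-≗ α+β≡n) (sum-const k n))
  σ+E : σ + E ≡ k * μ
  σ+E = trans (sym (∑-distrib-+ α e)) (trans (sum-cong-≗ α+e≡μ) (sum-const k μ))
  tangent : ∀ i → 2 * μ * α i + (α i * β i + e i * e i) ≡ n * α i + μ * μ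
  tangent i = subst₂ (λ n μ → 2 * μ * α i + (α i * β i + e i * e i) ≡ n * α i + μ * μ) (α+β≡n i) (α+e≡μ i) (lem4 (α i) (β i) (e i))
    where
    lem4 : ∀ a b e → 2 * (a + e) * a + (a * b + e * e) ≡ (a + b) * a + (a + e) * (a + e)
    lem4 = solve-∀
  open ≤-Reasoning
  total-tangent : 2 * μ * σ + Q ≡ n * σ + k * (μ * μ)
  total-tangent = begin-equality
    2 * μ * σ + Q                                                 ≡⟨ cong (_+ Q) (sum-*ˡ (2 * μ) α) ⟨
    sum (λ i → 2 * μ * α i) + Q                                   ≡⟨ ∑-distrib-+ {k} _ _ ⟨
    sum (λ i → 2 * μ * α i + (α i * β i + e i * e i))             ≡⟨ sum-cong-≗ tangent ⟩
    sum (λ i → n * α i + μ * μ)                                   ≡⟨ ∑-distrib-+ {k} _ _ ⟩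
    sum (λ i → n * α i) + sum {k} (λ _ → μ * μ)                   ≡⟨ cong₂ _+_ (sum-*ˡ n α) (sum-const k (μ * μ)) ⟩
    n * σ + k * (μ * μ)                                           ∎

-- The sum `γ + m` is constant along the induction, so both side conditions pass unchanged to the
-- slices, whose coefficient is `γ + 1`. Dividing by `D * n * n`, where `n = k ^ m`, gives boundary
-- density at least `(γ/D) a(1-a)`. In dimension 0 the density is 0 or 1 and the product vanishes.
isoperimetry : ∀ {k} m D γ → 2 * (γ + m) ≤ D → (γ + m) * (γ + m) * (γ + m) ≤ D * D → (A : Vec (Fin k) m → Bool) →
               D * k ^ m * card A + γ * (card A * card (not ∘ A)) ≤ D * k ^ m * card N[ A ]
isoperimetry zero D γ _ _ A = ≤-reflexive (trans (cong (λ z → D * 1 * card A + γ * z) (lemma (A []))) (trans (cong (D * 1 * card A +_) (*-zeroʳ γ)) (+-identityʳ _)))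
  where
  lemma : ∀ b → indicator b * indicator (not b) ≡ 0
  lemma true  = refl
  lemma false = refl
isoperimetry {k} (suc m) D γ 2γ≤D γ³≤D² A = begin
  D * (k * n) * σ + γ * (σ * τ)                                  ≤⟨ +-monoʳ-≤ _ (*-monoʳ-≤ γ (tangent-average α β e n μ (λ i → card-∁ (slice i)) α+e≡μ)) ⟩
  D * (k * n) * σ + γ * (k * sum Q)                              ≡⟨ lem1 D k n σ γ (sum Q) ⟩
  k * (D * n * σ + γ * sum Q)                                    ≡⟨ cong₂ (λ y z → k * (y + z)) (sum-*ˡ (D * n) α) (sum-*ˡ γ Q) ⟨
  k * (sum (λ i → D * n * α i) + sum (λ i → γ * Q i))            ≡⟨ cong (k *_) (∑-distrib-+ {k} _ _) ⟨
  k * sum (λ i → D * n * α i + γ * Q i)                          ≤⟨ *-monoʳ-≤ k (sum-mono pointwise) ⟩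
  k * sum (λ i → D * n * b i)                                    ≡⟨ cong (k *_) (sum-*ˡ (D * n) b) ⟩
  k * (D * n * sum b)                                            ≡⟨ lem2 k D n (sum b) ⟩
  D * (k * n) * sum b                                            ∎
  where
  open ≤-Reasoning
  lem1 : ∀ D k n σ γ Q → D * (k * n) * σ + γ * (k * Q) ≡ k * (D * n * σ + γ * Q)
  lem1 = solve-∀
  lem2 : ∀ k D n b → k * (D * n * b) ≡ D * (k * n) * b
  lem2 = solve-∀
  n = k ^ m
  slice : Fin k → Vec (Fin k) m → Bool
  slice i x = A (i ∷ x)
  α β b : Fin k → ℕ
  α i = card (slice i)
  β i = card (not ∘ slice i)
  b i = card (λ x → N[ A ] (i ∷ x))
  σ = sum α
  τ = sum β
  sup = supremum α
  μ = proj₁ sup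
  α≤μ = proj₁ (proj₂ sup)
  e : Fin k → ℕ
  e i = μ ∸ α i
  α+e≡μ : ∀ i → α i + e i ≡ μ
  α+e≡μ i = m+[n∸m]≡n (α≤μ i)
  Q : Fin k → ℕ
  Q i = α i * β i + e i * e i
  α≤n : ∀ i → α i ≤ n
  α≤n i = subst (α i ≤_) (card-∁ (slice i)) (m≤m+n _ _)
  -- Slice `i` of `N[ A ]` contains a copy of every slice of `A`, hence of the largest one.
  μ≤b : ∀ i → μ ≤ b i
  μ≤b i = proj₂ (proj₂ sup) (b i) λ j → card-mono λ x Ajx → ∨-introʳ (N[ slice i ] x) (anyFin⁺ (λ l → A (l ∷ x)) j Ajx)
  Dnα+ : ∀ i → D * n * b i ≡ D * n * α i + D * n * (b i ∸ α i)
  Dnα+ i = trans (cong (D * n *_) (sym (m+[n∸m]≡n (≤-trans (α≤μ i) (μ≤b i))))) (*-distribˡ-+ (D * n) (α i) _)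
  suc-shift : suc γ + m ≡ γ + suc m
  suc-shift = sym (+-suc γ m)
  γ≤ : γ ≤ γ + suc m
  γ≤ = m≤m+n γ (suc m)
  ih : ∀ i → D * n * α i + suc γ * (α i * β i) ≤ D * n * b i
  ih i = ≤-trans
    (isoperimetry m D (suc γ) (subst (λ z → 2 * z ≤ D) (sym suc-shift) 2γ≤D) (subst (λ z → z * z * z ≤ D * D) (sym suc-shift) γ³≤D²) (slice i))
    (*-monoʳ-≤ (D * n) (card-mono {A = N[ slice i ]} λ x → ∨-introˡ _))
  pointwise : ∀ i → D * n * α i + γ * Q i ≤ D * n * b i
  pointwise i = ≤-trans (+-monoʳ-≤ (D * n * α i) boundary) (≤-reflexive (sym (Dnα+ i)))
    where
    boundary : γ * Q i ≤ D * n * (b i ∸ α i)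
    boundary = slice-bound D γ n (α i * β i) (e i) (b i ∸ α i)
      (≤-trans (*-monoʳ-≤ 2 γ≤) 2γ≤D)
      (≤-trans (*-mono-≤ (*-mono-≤ γ≤ γ≤) γ≤) γ³≤D²)
      (subst (λ z → 4 * (α i * β i) ≤ z * z) (card-∁ (slice i)) (4xy≤[x+y]² (α i) (β i)))
      (≤-trans (m∸n≤m μ (α i)) (proj₂ (proj₂ sup) n α≤n))
      (+-cancelˡ-≤ (D * n * α i) _ _ (subst (D * n * α i + suc γ * (α i * β i) ≤_) (Dnα+ i) (ih i)))
      (∸-monoˡ-≤ (α i) (μ≤b i))

-- Enumeration of vertex sets

concatFin : ∀ {X : Set} {n} → (Fin n → List X) → List X
concatFin {n = zero}  f = []
concatFin {n = suc n} f = f zero ++ concatFin (f ∘ suc)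

length-concatFin : ∀ {X : Set} {n} (f : Fin n → List X) → length (concatFin f) ≡ sum (length ∘ f)
length-concatFin {n = zero}  f = refl
length-concatFin {n = suc n} f = trans (length-++ (f zero)) (cong (length (f zero) +_) (length-concatFin (f ∘ suc)))

∈-concatFin⁺ : ∀ {X : Set} {n} (f : Fin n → List X) i {x} → x ∈ f i → x ∈ concatFin f
∈-concatFin⁺ f zero    x∈ = ∈-++⁺ˡ x∈
∈-concatFin⁺ f (suc i) x∈ = ∈-++⁺ʳ (f zero) (∈-concatFin⁺ (f ∘ suc) i x∈)

elements : ∀ {k m} → (Vec (Fin k) m → Bool) → List (Vec (Fin k) m)
elements {m = zero}  A = if A [] then [] ∷ [] else []
elements {m = suc m} A = concatFin λ i → List.map (i ∷_) (elements λ x → A (i ∷ x))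

length-elements : ∀ {k m} (A : Vec (Fin k) m → Bool) → length (elements A) ≡ card A
length-elements {m = zero} A with A []
... | true  = refl
... | false = refl
length-elements {k} {suc m} A = trans (length-concatFin {n = k} _)
  (sum-cong-≗ λ i → trans (length-map (i ∷_) (elements λ x → A (i ∷ x))) (length-elements λ x → A (i ∷ x)))

∈-elements⁺ : ∀ {k m} (A : Vec (Fin k) m → Bool) x → A x ≡ true → x ∈ elements A
∈-elements⁺ A []      p rewrite p = here refl
∈-elements⁺ A (i ∷ x) p = ∈-concatFin⁺ _ i (∈-map⁺ (i ∷_) (∈-elements⁺ (λ y → A (i ∷ y)) x p))

vertices : ∀ {k} m → List (Vec (Fin k) m)
vertices m = elements (const true)

length-vertices : ∀ {k} m → length (vertices {k} m) ≡ k ^ m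
length-vertices {k} m = trans (length-elements {k} {m} (const true)) (trans (total-const m 1) (*-identityʳ _))

-- Upper bounds

-- Cops are indexed by the positions in the list. The cop at the position of a vertex equal or
-- adjacent to `r` goes to `r`; the others stay.
dominating⇒CopsWin : ∀ {k m} (L : List (Vec (Fin k) m)) →
                     (∀ x → ∃ λ y → y ∈ L × (y ≡ x ⊎ _~_ (CartPow (K k) m) y x)) →
                     CopsWin (CartPow (K k) m) (length L)
dominating⇒CopsWin {k} {m} L dominating = List.lookup L , λ r _ → capture r (dominating r)
  where
  open Game (CartPow (K k) m) (length L)
  capture : ∀ r → (∃ λ y → y ∈ L × (y ≡ r ⊎ _~_ (CartPow (K k) m) y r)) → CopWin (List.lookup L) r
  capture r (y , y∈L , near) = win C' move (inj₁ (i , caught))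
    where
    i = Any.index y∈L
    C' : Cops
    C' j = if does (j Fin.≟ i) then r else List.lookup L j
    near' : List.lookup L i ≡ r ⊎ _~_ (CartPow (K k) m) (List.lookup L i) r
    near' = subst (λ z → z ≡ r ⊎ _~_ (CartPow (K k) m) z r) (lookup-index y∈L) near
    move : CopMove (List.lookup L) C'
    move j with j Fin.≟ i
    ... | yes refl = near'
    ... | no _     = inj₁ refl
    caught : C' i ≡ r
    caught with i Fin.≟ i
    ... | yes _  = refl
    ... | no i≢i = contradiction refl i≢i

IsCInf⇒≤ : ∀ {G c c'} → IsCInf G c → CopsWin G c' → c ≤ c'
IsCInf⇒≤ (_ , least) wins = ≮⇒≥ λ c'<c → least _ c'<c wins

facet-CopsWin : ∀ k m → CopsWin (CartPow (K (suc k)) (suc m)) (suc k ^ m)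
facet-CopsWin k m = subst (CopsWin _) (trans (length-map (zero Vec.∷_) (vertices m)) (length-vertices m))
  (dominating⇒CopsWin (List.map (zero ∷_) (vertices m)) λ
    { (zero ∷ x)  → zero ∷ x , ∈-map⁺ (zero ∷_) (∈-elements⁺ (const true) x refl) , inj₁ refl
    ; (suc i ∷ x) → zero ∷ x , ∈-map⁺ (zero ∷_) (∈-elements⁺ (const true) x refl) , inj₂ (∼-head (λ ()) x) })

-- Hamming codes.

_⊕_ : Fin 2 → Fin 2 → Fin 2
zero     ⊕ b        = b
suc zero ⊕ zero     = suc zero
suc zero ⊕ suc zero = zero

⊕-involutive : ∀ a b → a ⊕ (a ⊕ b) ≡ b
⊕-involutive zero       b          = refl
⊕-involutive (suc zero) zero       = refl
⊕-involutive (suc zero) (suc zero) = refl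

⊕-comm : ∀ a b → a ⊕ b ≡ b ⊕ a
⊕-comm zero       zero       = refl
⊕-comm zero       (suc zero) = refl
⊕-comm (suc zero) zero       = refl
⊕-comm (suc zero) (suc zero) = refl

⊕-leftComm : ∀ a b c → a ⊕ (b ⊕ c) ≡ b ⊕ (a ⊕ c)
⊕-leftComm zero       b          c          = refl
⊕-leftComm (suc zero) zero       c          = refl
⊕-leftComm (suc zero) (suc zero) c          = refl

infixr 6 _⊞_
_⊞_ : ∀ {r} → Vec (Fin 2) r → Vec (Fin 2) r → Vec (Fin 2) r
_⊞_ = zipWith _⊕_

⊞-involutive : ∀ {r} (a b : Vec (Fin 2) r) → a ⊞ a ⊞ b ≡ b
⊞-involutive []      []      = refl
⊞-involutive (a ∷ u) (b ∷ v) = cong₂ _∷_ (⊕-involutive a b) (⊞-involutive u v)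

⊞-comm : ∀ {r} (a b : Vec (Fin 2) r) → a ⊞ b ≡ b ⊞ a
⊞-comm []      []      = refl
⊞-comm (a ∷ u) (b ∷ v) = cong₂ _∷_ (⊕-comm a b) (⊞-comm u v)

⊞-leftComm : ∀ {r} (a b c : Vec (Fin 2) r) → a ⊞ b ⊞ c ≡ b ⊞ a ⊞ c
⊞-leftComm []      []      []      = refl
⊞-leftComm (a ∷ u) (b ∷ v) (c ∷ w) = cong₂ _∷_ (⊕-leftComm a b c) (⊞-leftComm u v w)

-- The Hamming syndrome of the 0/1-vector marking the nonzero entries of x, for the parity check matrix
-- with columns H; coordinates beyond the length of H are ignored.
syndrome : ∀ {k r m} → List (Vec (Fin 2) r) → Vec (Fin (2 + k)) m → Vec (Fin 2) r
syndrome []      x           = replicate _ zero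
syndrome (h ∷ H) []          = replicate _ zero
syndrome (h ∷ H) (zero ∷ x)  = syndrome H x
syndrome (h ∷ H) (suc _ ∷ x) = h ⊞ syndrome H x

-- Toggling the coordinate that carries column `h` between zero and nonzero adds `h` to the
-- syndrome, as `h ⊞ h` vanishes. The bound on `length H` ensures that this coordinate exists.
syndrome-shift : ∀ {k r m} {H : List (Vec (Fin 2) r)} {h} → h ∈ H → length H ≤ m → (x : Vec (Fin (2 + k)) m) →
                 ∃ λ y → _~_ (CartPow (K (2 + k)) m) x y × syndrome H y ≡ h ⊞ syndrome H x
syndrome-shift (here refl) (s≤s _) (zero ∷ x)  = suc zero ∷ x , ∼-head (λ ()) x , refl
syndrome-shift (here refl) (s≤s _) (suc i ∷ x) = zero ∷ x , ∼-head (λ ()) x , sym (⊞-involutive _ _)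
syndrome-shift (there h∈H) (s≤s |H|≤m) (zero ∷ x) with syndrome-shift h∈H |H|≤m x
... | y , x~y , eq = zero ∷ y , ∼-tail zero x~y , eq
syndrome-shift {H = g ∷ _} {h} (there h∈H) (s≤s |H|≤m) (suc i ∷ x) with syndrome-shift h∈H |H|≤m x
... | y , x~y , eq = suc i ∷ y , ∼-tail (suc i) x~y , trans (cong (g ⊞_) eq) (⊞-leftComm g h _)

minimumVec : ∀ {k m} (w : Vec (Fin (suc k)) m → ℕ) → ∃ λ x → ∀ y → w x ≤ w y
minimumVec {m = zero}  w = [] , λ { [] → ≤-refl }
minimumVec {m = suc m} w =
  let tails        = λ i → minimumVec λ x → w (i ∷ x)
      i , i-least  = minimum λ i → w (i ∷ proj₁ (tails i))
  in i ∷ proj₁ (tails i) , λ { (j ∷ y) → ≤-trans (i-least j) (proj₂ (tails j) y) }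

total-swap : ∀ {k l m r} (w : Vec (Fin k) m → Vec (Fin l) r → ℕ) →
             total (λ x → total (w x)) ≡ total (λ t → total λ x → w x t)
total-swap {r = zero}  w = refl
total-swap {r = suc r} w = trans (total-sum λ i x → total λ t → w x (i ∷ t)) (sum-cong-≗ λ i → total-swap λ x t → w x (i ∷ t))

-- The fibres partition the `k ^ m` vertices, so the smallest has at most the average size.
small-fibre : ∀ {k l m r} (f : Vec (Fin k) m → Vec (Fin (suc l)) r) → ∃ λ t → suc l ^ r * card (λ x → is (f x) t) ≤ k ^ m
small-fibre {k} {l} {m} {r} f with minimumVec (λ t → card λ x → is (f x) t)
... | t , least = t , (begin
  suc l ^ r * card (λ x → is (f x) t)                  ≡⟨ total-const r _ ⟨
  total {suc l} {r} (λ _ → card λ x → is (f x) t)      ≤⟨ total-mono least ⟩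
  total (λ u → card λ x → is (f x) u)                  ≡⟨ total-swap (λ x u → indicator (is (f x) u)) ⟨
  total (λ x → card (is (f x)))                        ≡⟨ total-cong (λ x → card-point (f x)) ⟩
  total {k} {m} (λ _ → 1)                              ≡⟨ total-const m 1 ⟩
  k ^ m * 1                                            ≡⟨ *-identityʳ _ ⟩
  k ^ m                                                ∎)
  where open ≤-Reasoning

Hamming-CopsWin : ∀ k m r → 2 ^ r ≤ m → ∃ λ c → 2 ^ r * c ≤ (2 + k) ^ m × CopsWin (CartPow (K (2 + k)) m) c
Hamming-CopsWin k m r 2^r≤m with small-fibre (syndrome {k} {r} {m} (vertices r))
... | t , small = card code , small , subst (CopsWin _) (length-elements code) (dominating⇒CopsWin (elements code) dominating)
  where
  -- All `2 ^ r` vectors serve as columns, the zero vector among them, so the correction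
  -- `syndrome H x ⊞ t` is always a column.
  H = vertices r
  code : Vec (Fin (2 + k)) m → Bool
  code x = is (syndrome H x) t
  dominating : ∀ x → ∃ λ y → y ∈ elements code × (y ≡ x ⊎ _~_ (CartPow (K (2 + k)) m) y x)
  dominating x with syndrome-shift (∈-elements⁺ (const true) (syndrome H x ⊞ t) refl) (≤-trans (≤-reflexive (length-vertices r)) 2^r≤m) x
  ... | y , x~y , eq = y , ∈-elements⁺ code y (subst (λ z → is z t ≡ true) (sym eq') (is⁺ t)) , inj₂ (∼-sym x y x~y)
    where
    eq' : syndrome H y ≡ t
    eq' = trans eq (trans (⊞-comm _ _) (⊞-involutive _ _))

log₂-bounds : ∀ m → ∃ λ r → 2 ^ r ≤ suc m × suc m ≤ 2 * 2 ^ r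
log₂-bounds zero    = 0 , s≤s z≤n , s≤s z≤n
log₂-bounds (suc m) with log₂-bounds m
... | r , lo , hi with suc (suc m) ≤? 2 * 2 ^ r
...   | yes hi' = r , m≤n⇒m≤1+n lo , hi'
...   | no ¬hi' = suc r , <⇒≤ (≰⇒> ¬hi') , (begin
  suc (suc m)           ≤⟨ s≤s hi ⟩
  1 + 2 * 2 ^ r         ≤⟨ +-monoˡ-≤ _ (≤-trans (s≤s z≤n) hi) ⟩
  2 * 2 ^ r + 2 * 2 ^ r ≡⟨ cong (2 * 2 ^ r +_) (+-identityʳ _) ⟨
  2 * (2 * 2 ^ r)       ∎)
  where open ≤-Reasoning

-- The code has at most `n / 2 ^ r` vertices, and `2 ^ r` is at least half the dimension. This bound
-- of order `n/m` serves both parts of the theorem.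
c∞-upper : ∀ k m c → IsCInf (CartPow (K (2 + k)) (suc m)) c → c * suc m ≤ 2 * (2 + k) ^ suc m
c∞-upper k m c isC with log₂-bounds m
... | r , lo , hi with Hamming-CopsWin k (suc m) r lo
...   | c' , small , wins = begin
  c * suc m                 ≤⟨ *-mono-≤ (IsCInf⇒≤ isC wins) hi ⟩
  c' * (2 * 2 ^ r)          ≡⟨ lemma c' (2 ^ r) ⟩
  2 * (2 ^ r * c')          ≤⟨ *-monoʳ-≤ 2 small ⟩
  2 * (2 + k) ^ suc m       ∎
  where
  open ≤-Reasoning
  lemma : ∀ c p → c * (2 * p) ≡ 2 * (p * c)
  lemma = solve-∀

-- Lower bound

-- Finite double-negation shift: inside the proof of a negation, connectivity may be assumed
-- decidable for all pairs of vertices at once.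
¬¬-∀Fin : ∀ {n} {P : Fin n → Set} → (∀ i → ¬ ¬ P i) → ¬ ¬ (∀ i → P i)
¬¬-∀Fin {zero}  h ¬all = ¬all λ ()
¬¬-∀Fin {suc n} h ¬all = h zero λ p₀ → ¬¬-∀Fin (h ∘ suc) λ ps → ¬all λ { zero → p₀ ; (suc i) → ps i }

¬¬-∀Vec : ∀ {k m} {P : Vec (Fin k) m → Set} → (∀ x → ¬ ¬ P x) → ¬ ¬ (∀ x → P x)
¬¬-∀Vec {m = zero}  h ¬all = h [] λ p → ¬all λ { [] → p }
¬¬-∀Vec {m = suc m} h ¬all = ¬¬-∀Fin (λ i → ¬¬-∀Vec λ x → h (i ∷ x)) λ ps → ¬all λ { (i ∷ x) → ps i x }

-- Large components outside a small set.

module Components {k m : ℕ} (S : Vec (Fin k) m → Bool) where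

  _~ᴳ_ : Vec (Fin k) m → Vec (Fin k) m → Set
  _~ᴳ_ = _~_ (CartPow (K k) m)

  FreeEdge : Vec (Fin k) m → Vec (Fin k) m → Set
  FreeEdge u v = u ~ᴳ v × S u ≡ false × S v ≡ false

  Connected : Vec (Fin k) m → Vec (Fin k) m → Set
  Connected = Star FreeEdge

  Connected-sym : ∀ {u v} → Connected u v → Connected v u
  Connected-sym = reverse λ { {u} {v} (u~v , Su , Sv) → ∼-sym u v u~v , Sv , Su }

  Connected⇒free : ∀ {u v} → S u ≡ false → Connected u v → S v ≡ false
  Connected⇒free Su ε                    = Su
  Connected⇒free Su ((_ , _ , Sv) ◅ path) = Connected⇒free Sv path

  -- The strict majority makes any two havens meet, even if they belong to different sets `S`.
  record Haven : Set where
    field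
      X         : Vec (Fin k) m → Bool
      big       : k ^ m < 2 * card X
      free      : ∀ x → X x ≡ true → S x ≡ false
      connected : ∀ x y → X x ≡ true → X y ≡ true → Connected x y

  Closed : (Vec (Fin k) m → Bool) → Set
  Closed X = ∀ y x → X y ≡ true → y ~ᴳ x → S x ≡ false → X x ≡ true

  -- An edge leaving a closed set ends in `S`, so the outer boundary lies in `S`.
  card-N[Closed] : ∀ X → Closed X → card N[ X ] ≤ card X + card S
  card-N[Closed] X closed = ≤-trans (card-mono N[X]⊆X∪S) (card-∪ X S)
    where
    N[X]⊆X∪S : ∀ x → N[ X ] x ≡ true → X x ∨ S x ≡ true
    N[X]⊆X∪S x p with S x in Sx | N[]⁻ X x p
    ... | true  | _                    = ∨-introʳ (X x) refl
    ... | false | .x , Xx , inj₁ refl  = ∨-introˡ _ Xx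
    ... | false | y  , Xy , inj₂ y~x   = ∨-introˡ _ (closed y x Xy y~x Sx)

  module _ (s : ℕ) (1≤m : 1 ≤ m) (m≤s² : m ≤ s * s) (small : 32 * s * card S < k ^ m) where

    private
      n = k ^ m
      instance
        m≢0 : NonZero m
        m≢0 = >-nonZero 1≤m
        n≢0 : NonZero n
        n≢0 = >-nonZero (≤-<-trans z≤n small)

      1≤s : 1 ≤ s
      1≤s = >-nonZero⁻¹ s {{m*n≢0⇒m≢0 s {{>-nonZero (≤-trans 1≤m m≤s²)}}}}

    -- Isoperimetry with γ = m and D = 4sm, i.e. boundary density at least a(1-a)/(4s).
    Closed⇒card-product : ∀ X → Closed X → card X * card (not ∘ X) ≤ 4 * s * n * card S
    Closed⇒card-product X closed = *-cancelˡ-≤ m (+-cancelˡ-≤ (4 * s * m * n * card X) _ _ (begin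
      4 * s * m * n * card X + m * (card X * card (not ∘ X))   ≤⟨ isoperimetry m (4 * s * m) m cond₁ cond₂ X ⟩
      4 * s * m * n * card N[ X ]                              ≤⟨ *-monoʳ-≤ (4 * s * m * n) (card-N[Closed] X closed) ⟩
      4 * s * m * n * (card X + card S)                        ≡⟨ lem s m n (card X) (card S) ⟩
      4 * s * m * n * card X + m * (4 * s * n * card S)        ∎))
      where
      open ≤-Reasoning
      lem : ∀ s m n α σ → 4 * s * m * n * (α + σ) ≡ 4 * s * m * n * α + m * (4 * s * n * σ)
      lem = solve-∀
      cond₁ : 2 * (m + m) ≤ 4 * s * m
      cond₁ = begin
        2 * (m + m)    ≡⟨ lem₁ m ⟩
        4 * 1 * m      ≤⟨ *-monoˡ-≤ m (*-monoʳ-≤ 4 1≤s) ⟩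
        4 * s * m      ∎
        where
        lem₁ : ∀ m → 2 * (m + m) ≡ 4 * 1 * m
        lem₁ = solve-∀
      cond₂ : (m + m) * (m + m) * (m + m) ≤ 4 * s * m * (4 * s * m)
      cond₂ = begin
        (m + m) * (m + m) * (m + m)    ≡⟨ lem₂ m ⟩
        8 * m * (m * m)                ≤⟨ *-monoˡ-≤ (m * m) (*-mono-≤ {8} {16} (m≤m+n 8 8) m≤s²) ⟩
        16 * (s * s) * (m * m)         ≡⟨ lem₃ s m ⟩
        4 * s * m * (4 * s * m)        ∎
        where
        lem₂ : ∀ m → (m + m) * (m + m) * (m + m) ≡ 8 * m * (m * m)
        lem₂ = solve-∀
        lem₃ : ∀ s m → 16 * (s * s) * (m * m) ≡ 4 * s * m * (4 * s * m)
        lem₃ = solve-∀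

    -- If `X` had between `n/4` and `n/2` vertices, then `card X * card (not ∘ X)` would be at least
    -- `n²/8`, while isoperimetry bounds it by `4sn * card S`. Hence the constant 32 = 8 · 4 in
    -- `small`.
    Closed-gap : ∀ X → Closed X → 2 * card X ≤ n → 4 * card X < n
    Closed-gap X closed 2α≤n = ≰⇒> λ n≤4α → <-irrefl refl (begin-strict
      n * n                                  ≤⟨ *-mono-≤ n≤4α n≤2β ⟩
      4 * card X * (2 * card (not ∘ X))      ≡⟨ lem₁ (card X) (card (not ∘ X)) ⟩
      8 * (card X * card (not ∘ X))          ≤⟨ *-monoʳ-≤ 8 (Closed⇒card-product X closed) ⟩
      8 * (4 * s * n * card S)               ≡⟨ lem₂ s n (card S) ⟩
      32 * s * card S * n                    <⟨ *-monoˡ-< n small ⟩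
      n * n                                  ∎)
      where
      open ≤-Reasoning
      lem₁ : ∀ α β → 4 * α * (2 * β) ≡ 8 * (α * β)
      lem₁ = solve-∀
      lem₂ : ∀ s n σ → 8 * (4 * s * n * σ) ≡ 32 * s * σ * n
      lem₂ = solve-∀
      n≤2β : n ≤ 2 * card (not ∘ X)
      n≤2β = +-cancelˡ-≤ (2 * card X) _ _ (begin
        2 * card X + n                          ≤⟨ +-monoˡ-≤ n 2α≤n ⟩
        n + n                                   ≡⟨ cong (n +_) (+-identityʳ n) ⟨
        2 * n                                   ≡⟨ cong (2 *_) (card-∁ X) ⟨
        2 * (card X + card (not ∘ X))           ≡⟨ *-distribˡ-+ 2 (card X) _ ⟩
        2 * card X + 2 * card (not ∘ X)         ∎)

    -- If no component had more than n/2 vertices, then adding the components one by one would keep the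
    -- union below n/4 throughout, as a closed set never has between n/4 and n/2 vertices.
    ¬¬Haven : ¬ ¬ Haven
    ¬¬Haven ¬haven = ¬¬-∀Vec (λ r → ¬¬-∀Vec λ x → ¬¬-excluded-middle {A = Connected r x}) absurd
      where
      absurd : ¬ (∀ r x → Dec (Connected r x))
      absurd connected? = <-irrefl refl contra
        where
        comp : Vec (Fin k) m → Vec (Fin k) m → Bool
        -- The empty path connects even a vertex of `S` to itself; the test on `S r` makes its
        -- component empty.
        comp r x = not (S r) ∧ does (connected? r x)

        comp⁺ : ∀ {r x} → S r ≡ false → Connected r x → comp r x ≡ true
        comp⁺ {r} {x} Sr path rewrite Sr with connected? r x
        ... | yes _ = refl
        ... | no ¬p = contradiction path ¬p

        comp⁻ : ∀ r x → comp r x ≡ true → S r ≡ false × Connected r x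
        comp⁻ r x p with S r | connected? r x
        ... | false | yes path = refl , path

        comp-closed : ∀ r → Closed (comp r)
        comp-closed r y x p y~x Sx with comp⁻ r y p
        ... | Sr , path = comp⁺ Sr (path ◅◅ ((y~x , Connected⇒free Sr path , Sx) ◅ ε))

        comp-small : ∀ r → 4 * card (comp r) < n
        comp-small r = Closed-gap (comp r) (comp-closed r) (≮⇒≥ λ big → ¬haven record
          { X         = comp r
          ; big       = big
          ; free      = λ x p → let Sr , path = comp⁻ r x p in Connected⇒free Sr path
          ; connected = λ x y p q → Connected-sym (proj₂ (comp⁻ r x p)) ◅◅ proj₂ (comp⁻ r y q)
          })

        U : List (Vec (Fin k) m) → Vec (Fin k) m → Bool
        U []       x = false
        U (r ∷ rs) x = comp r x ∨ U rs x

        U-closed : ∀ rs → Closed (U rs)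
        U-closed (r ∷ rs) y x p y~x Sx with ∨-elim (comp r y) p
        ... | inj₁ q = ∨-introˡ _ (comp-closed r y x q y~x Sx)
        ... | inj₂ q = ∨-introʳ (comp r x) (U-closed rs y x q y~x Sx)

        U⁺ : ∀ {r rs} → r ∈ rs → S r ≡ false → U rs r ≡ true
        U⁺ (here refl) Sr = ∨-introˡ _ (comp⁺ Sr ε)
        U⁺ (there r∈)  Sr = ∨-introʳ (comp _ _) (U⁺ r∈ Sr)

        open ≤-Reasoning

        U-small : ∀ rs → 4 * card (U rs) < n
        U-small []       = subst (λ z → 4 * z < n) (sym (trans (total-const m 0) (*-zeroʳ n))) (>-nonZero⁻¹ n)
        U-small (r ∷ rs) = Closed-gap (U (r ∷ rs)) (U-closed (r ∷ rs)) (*-cancelˡ-≤ 2 (begin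
          2 * (2 * card (U (r ∷ rs)))                ≡⟨ *-assoc 2 2 (card (U (r ∷ rs))) ⟨
          4 * card (U (r ∷ rs))                      ≤⟨ *-monoʳ-≤ 4 (card-∪ (comp r) (U rs)) ⟩
          4 * (card (comp r) + card (U rs))          ≡⟨ *-distribˡ-+ 4 (card (comp r)) _ ⟩
          4 * card (comp r) + 4 * card (U rs)        ≤⟨ +-mono-≤ (<⇒≤ (comp-small r)) (<⇒≤ (U-small rs)) ⟩
          n + n                                      ≡⟨ cong (n +_) (+-identityʳ n) ⟨
          2 * n                                      ∎))

        ∁S⊆U : ∀ x → not (S x) ≡ true → U (vertices m) x ≡ true
        ∁S⊆U x p with S x in Sx
        ... | false = U⁺ (∈-elements⁺ (const true) x refl) Sx

        -- `S` and the union of all components have at most `n/4` vertices each, yet together they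
        -- cover everything.
        contra : 4 * n < 4 * n
        contra = begin-strict
          4 * n                                       ≡⟨ cong (4 *_) (card-∁ S) ⟨
          4 * (card S + card (not ∘ S))               ≡⟨ *-distribˡ-+ 4 (card S) _ ⟩
          4 * card S + 4 * card (not ∘ S)             ≤⟨ +-mono-≤ 4σ≤n (*-monoʳ-≤ 4 (card-mono ∁S⊆U)) ⟩
          n + 4 * card (U (vertices m))               <⟨ +-monoʳ-< n (U-small (vertices m)) ⟩
          n + n                                       ≤⟨ +-monoʳ-≤ n (m≤m+n n _) ⟩
          4 * n                                       ∎
          where
          4σ≤n : 4 * card S ≤ n
          4σ≤n = ≤-trans (*-monoˡ-≤ (card S) (*-mono-≤ {4} {32} (m≤m+n 4 28) 1≤s)) (<⇒≤ small)

-- The robber's strategy.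

module Robber {k m c : ℕ} where

  open Game (CartPow (K k) m) c

  occupied : Cops → Vec (Fin k) m → Bool
  occupied C x = anyFin λ i → is (C i) x

  threatened : Cops → Vec (Fin k) m → Bool
  threatened C = N[ occupied C ]

  card-threatened : ∀ C → card (threatened C) ≤ (1 + m * k) * c
  card-threatened C = ≤-trans (card-N[] (occupied C)) (*-monoʳ-≤ (1 + m * k) (begin
    card (occupied C)            ≤⟨ card-anyFin (λ i → is (C i)) ⟩
    sum (λ i → card (is (C i)))  ≡⟨ sum-cong-≗ (λ i → card-point (C i)) ⟩
    sum {c} (λ _ → 1)            ≡⟨ sum-const c 1 ⟩
    c * 1                        ≡⟨ *-identityʳ c ⟩
    c                            ∎))
    where open ≤-Reasoning

  occupied⁺ : ∀ C i → occupied C (C i) ≡ true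
  occupied⁺ C i = anyFin⁺ (λ j → is (C j) (C i)) i (is⁺ (C i))

  -- One cop move stays within the closed neighbourhood of the old positions. Hence paths that avoid
  -- `threatened C` remain open after the cops have moved.
  unthreatened⇒¬Occ : ∀ {C C' x} → CopMove C C' → threatened C x ≡ false → ¬ Occ C' x
  unthreatened⇒¬Occ {C} {C'} move safe (i , refl) with trans (sym safe) (reach (move i))
    where
    reach : C i ≡ C' i ⊎ _~_ (CartPow (K k) m) (C i) (C' i) → threatened C (C' i) ≡ true
    reach (inj₁ eq)  = A⊆N[A] (occupied C) (C' i) (subst (λ z → occupied C z ≡ true) eq (occupied⁺ C i))
    reach (inj₂ adj) = N[]-closed (occupied C) {C i} {C' i} (occupied⁺ C i) adj
  ... | ()

  Connected⇒Avoid : ∀ {C C' u v} → CopMove C C' → Components.Connected (threatened C) u v → Avoid C' u v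
  Connected⇒Avoid move ε                          = here
  Connected⇒Avoid move ((u~v , _ , safe) ◅ path) = step u~v (unthreatened⇒¬Occ move safe) (Connected⇒Avoid move path)

  module _ (s : ℕ) (1≤m : 1 ≤ m) (m≤s² : m ≤ s * s) (small : 32 * s * ((1 + m * k) * c) < k ^ m) where

    open Components using (Haven)
    open Haven

    ¬¬haven : ∀ C → ¬ ¬ Haven (threatened C)
    ¬¬haven C = Components.¬¬Haven (threatened C) s 1≤m m≤s² (≤-<-trans (*-monoʳ-≤ (32 * s) (card-threatened C)) small)

    ¬disjoint : ∀ C C' (H : Haven (threatened C)) (H' : Haven (threatened C')) → ¬ (∀ x → X H x ≡ true → X H' x ≡ true → ⊥)
    ¬disjoint C C' H H' disjoint = <-irrefl refl (begin-strict
      2 * k ^ m                          ≡⟨ cong (k ^ m +_) (+-identityʳ (k ^ m)) ⟩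
      k ^ m + k ^ m                      <⟨ +-mono-< (big H) (big H') ⟩
      2 * card (X H) + 2 * card (X H')   ≡⟨ *-distribˡ-+ 2 (card (X H)) _ ⟨
      2 * (card (X H) + card (X H'))     ≤⟨ *-monoʳ-≤ 2 (card-disjoint (X H) (X H') disjoint) ⟩
      2 * k ^ m                          ∎)
      where open ≤-Reasoning

    -- Induction on the cops' winning tree; the invariant is that the robber sits in a haven of the
    -- current position. The old haven is still free after the move to `C'` and meets the haven of
    -- `C'`, so the robber runs to a common vertex. The new haven and this vertex are known only up
    -- to double negation, which suffices for a negation.
    ¬CopWin : ∀ {C r} (H : Haven (threatened C)) → X H r ≡ true → ¬ CopWin C r
    ¬CopWin {C} {r} H Xr (win C' move (inj₁ caught)) = unthreatened⇒¬Occ move (free H r Xr) caught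
    ¬CopWin {C} {r} H Xr (win C' move (inj₂ f))      = ¬¬haven C' λ H' → ¬disjoint C C' H H' λ y Xy X'y →
      ¬CopWin H' X'y (f y (Connected⇒Avoid move (connected H r y Xr Xy)))

    ¬CopsWin : ¬ Game.CopsWin (CartPow (K k) m) c
    -- Intersecting the haven with itself supplies a start vertex; the idle move shows that it is
    -- unoccupied.
    ¬CopsWin (C , wins) = ¬¬haven C λ H → ¬disjoint C C H H λ r Xr _ →
      ¬CopWin H Xr (wins r (unthreatened⇒¬Occ (λ _ → inj₁ refl) (free H r Xr)))

-- Explicit constants.

√-bounds : ∀ m → ∃ λ s → suc m ≤ s * s × s * s ≤ 4 * suc m
√-bounds zero    = 1 , s≤s z≤n , s≤s z≤n
√-bounds (suc m) with √-bounds m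
... | s , lo , hi with suc (suc m) ≤? s * s
...   | yes lo' = s , lo' , ≤-trans hi (*-monoʳ-≤ 4 (n≤1+n (suc m)))
-- Doubling happens only when `s * s` is below the new dimension, so the new square is at most four
-- times that dimension.
...   | no ¬lo' = 2 * s , (begin
  suc (suc m)           ≤⟨ s≤s lo ⟩
  1 + s * s             ≤⟨ +-monoˡ-≤ (s * s) (≤-trans (s≤s z≤n) lo) ⟩
  s * s + s * s         ≤⟨ m≤m+n _ (2 * (s * s)) ⟩
  s * s + s * s + 2 * (s * s) ≡⟨ lemma s ⟩
  2 * s * (2 * s)       ∎) , (begin
  2 * s * (2 * s)       ≡⟨ *-assoc 2 s (2 * s) ⟩
  2 * (s * (2 * s))     ≡⟨ lemma' s ⟩
  4 * (s * s)           ≤⟨ *-monoʳ-≤ 4 (<⇒≤ (≰⇒> ¬lo')) ⟩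
  4 * suc (suc m)       ∎)
  where
  open ≤-Reasoning
  lemma : ∀ s → s * s + s * s + 2 * (s * s) ≡ 2 * s * (2 * s)
  lemma = solve-∀
  lemma' : ∀ s → 2 * (s * (2 * s)) ≡ 4 * (s * s)
  lemma' = solve-∀

-- Squaring removes the root from `n ≤ 128 c k m √m`. Here 128 = 32 · 2 · 2, with one factor 2 from
-- `1 + m * k ≤ 2 * (m * k)` and one from `s ≤ 2√m`.
c∞-lower : ∀ k m c → 1 ≤ k → 1 ≤ m → CopsWin (CartPow (K k) m) c →
           k ^ m * k ^ m ≤ 128 * c * k * (128 * c * k) * (m * m * m)
c∞-lower (suc k') (suc m') c 1≤k 1≤m wins with √-bounds m'
... | s , m≤s² , s²≤4m = begin
  n * n                                               ≤⟨ *-mono-≤ n≤ n≤ ⟩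
  64 * s * (m * k * c) * (64 * s * (m * k * c))       ≡⟨ lem₁ s m k c ⟩
  s * s * (64 * (m * k * c) * (64 * (m * k * c)))     ≤⟨ *-monoˡ-≤ _ s²≤4m ⟩
  4 * m * (64 * (m * k * c) * (64 * (m * k * c)))     ≡⟨ lem₂ m k c ⟩
  128 * c * k * (128 * c * k) * (m * m * m)           ∎
  where
  open ≤-Reasoning
  k = suc k'
  m = suc m'
  n = k ^ m
  lem₁ : ∀ s m k c → 64 * s * (m * k * c) * (64 * s * (m * k * c)) ≡ s * s * (64 * (m * k * c) * (64 * (m * k * c)))
  lem₁ = solve-∀
  lem₂ : ∀ m k c → 4 * m * (64 * (m * k * c) * (64 * (m * k * c))) ≡ 128 * c * k * (128 * c * k) * (m * m * m)
  lem₂ = solve-∀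
  lem₃ : ∀ s x c → 32 * s * ((x + x) * c) ≡ 64 * s * (x * c)
  lem₃ = solve-∀
  n≤ : n ≤ 64 * s * (m * k * c)
  n≤ = begin
    n                                  ≤⟨ ≮⇒≥ (λ small → Robber.¬CopsWin s 1≤m m≤s² small wins) ⟩
    32 * s * ((1 + m * k) * c)         ≤⟨ *-monoʳ-≤ (32 * s) (*-monoˡ-≤ c (+-monoˡ-≤ (m * k) {1} {m * k} (s≤s z≤n))) ⟩
    32 * s * ((m * k + m * k) * c)     ≡⟨ lem₃ s (m * k) c ⟩
    64 * s * (m * k * c)               ∎

-- The quotients `p / q` and `a / b` are the lower and upper constants: 1/128 and 2 in (a), 1/256
-- and 2 in (b). Bounds involving `√m` are squared, and the minimum becomes a conjunction.
theorem6p2 : (Σ ℕ λ p → Σ ℕ λ q → Σ ℕ λ a → Σ ℕ λ b →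
    1 ≤ p × 1 ≤ q × 1 ≤ a × 1 ≤ b ×
    ((k m c : ℕ) → 2 ≤ k → 1 ≤ m → IsCInf (CartPow (K k) m) c →
    (p * (k ^ m)) * (p * (k ^ m)) ≤ (q * c * k) * (q * c * k) * (m * m * m)
    × c * k ≤ k ^ m
    × (b * c) * (b * c) * m ≤ (a * (k ^ m)) * (a * (k ^ m))))
    ×
    (Σ ℕ λ p → Σ ℕ λ q → Σ ℕ λ a → Σ ℕ λ b →
    1 ≤ p × 1 ≤ q × 1 ≤ a × 1 ≤ b ×
    ((m c : ℕ) → 1 ≤ m → IsCInf (Hypercube m) c →
    (p * (2 ^ m)) * (p * (2 ^ m)) ≤ (q * c) * (q * c) * (m * m * m)
    × b * c * m ≤ a * (2 ^ m)))
theorem6p2 = (1 , 128 , 2 , 1 , s≤s z≤n , s≤s z≤n , s≤s z≤n , s≤s z≤n , part-a)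
           , (1 , 256 , 2 , 1 , s≤s z≤n , s≤s z≤n , s≤s z≤n , s≤s z≤n , part-b)
  where
  open ≤-Reasoning
  part-a : (k m c : ℕ) → 2 ≤ k → 1 ≤ m → IsCInf (CartPow (K k) m) c →
           (1 * (k ^ m)) * (1 * (k ^ m)) ≤ (128 * c * k) * (128 * c * k) * (m * m * m)
           × c * k ≤ k ^ m
           × (1 * c) * (1 * c) * m ≤ (2 * (k ^ m)) * (2 * (k ^ m))
  part-a (suc (suc k')) (suc m') c (s≤s (s≤s _)) 1≤m isC = lower , upper₁ , upper₂
    where
    k = 2 + k'
    m = suc m'
    n = k ^ m
    lower : (1 * n) * (1 * n) ≤ (128 * c * k) * (128 * c * k) * (m * m * m)
    lower = subst (λ z → z * z ≤ 128 * c * k * (128 * c * k) * (m * m * m)) (sym (*-identityˡ n)) (c∞-lower k m c (s≤s z≤n) 1≤m (proj₁ isC))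
    upper₁ : c * k ≤ n
    upper₁ = ≤-trans (*-monoˡ-≤ k (IsCInf⇒≤ isC (facet-CopsWin (suc k') m'))) (≤-reflexive (*-comm (k ^ m') k))
    upper₂ : (1 * c) * (1 * c) * m ≤ (2 * n) * (2 * n)
    upper₂ = begin
      -- As `1 ≤ m`, `c²m` is at most `(cm)²`, so the bound of order `n/m` implies the one of order
      -- `n/√m`.
      1 * c * (1 * c) * m     ≤⟨ m≤m*n _ m ⟩
      1 * c * (1 * c) * m * m ≡⟨ square c m ⟩
      c * m * (c * m)         ≤⟨ *-mono-≤ (c∞-upper k' m' c isC) (c∞-upper k' m' c isC) ⟩
      2 * n * (2 * n)         ∎
      where
      square : ∀ c m → 1 * c * (1 * c) * m * m ≡ c * m * (c * m)
      square = solve-∀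
  part-b : (m c : ℕ) → 1 ≤ m → IsCInf (Hypercube m) c →
           (1 * (2 ^ m)) * (1 * (2 ^ m)) ≤ (256 * c) * (256 * c) * (m * m * m)
           × 1 * c * m ≤ 2 * (2 ^ m)
  part-b (suc m') c 1≤m isC = lower , upper
    where
    m = suc m'
    lower : (1 * (2 ^ m)) * (1 * (2 ^ m)) ≤ (256 * c) * (256 * c) * (m * m * m)
    lower = begin
      1 * 2 ^ m * (1 * 2 ^ m)                       ≡⟨ cong (λ z → z * z) (*-identityˡ (2 ^ m)) ⟩
      2 ^ m * 2 ^ m                                 ≤⟨ c∞-lower 2 m c (s≤s z≤n) 1≤m (proj₁ isC) ⟩
      128 * c * 2 * (128 * c * 2) * (m * m * m)     ≡⟨ cong (λ z → z * z * (m * m * m)) (double c) ⟩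
      256 * c * (256 * c) * (m * m * m)             ∎
      where
      double : ∀ c → 128 * c * 2 ≡ 256 * c
      double = solve-∀
    upper : 1 * c * m ≤ 2 * 2 ^ m
    upper = subst (λ z → z * m ≤ 2 * 2 ^ m) (sym (*-identityˡ c)) (c∞-upper 0 m' c isC)
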